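{- Let $s'>1$ be finite or countably infinite, and let $\Gamma$ be a grid of order $(s',1)$. Then there exist a thick infinite generalized quadrangle $\overline{A}$ and an epimorphism $\overline{\epsilon}:\overline{A}\to\Gamma$. (In particular, an epimorphism from an infinite thick generalized quadrangle onto a grid of order $(s',1)$ need not have $s'=1$, in contrast to the finite case.)
   Context: A point-line geometry is a weak generalized $4$-gon if any two elements (points or lines) lie in a common ordinary sub $4$-gon and there are no ordinary sub $k$-gons for $k=2,3$; it is a (thick) generalized quadrangle if moreover every point is on at least three lines and every line has at least three points. Order $(u,v)$ means that each line is incident with $u+1$ points and each point with $v+1$ lines ($u$, $v$ possibly infinite cardinals). A grid of order $(s',1)$ is a weak generalized $4$-gon of order $(s',1)$. A morphism maps points to points, lines to lines, and preserves incidence. An epimorphism is a morphism that is surjective on points and surjective on lines. -}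

module Defs where

open import Data.Fin.Base using (Fin; toℕ)
open import Data.Maybe.Base using (Maybe)
open import Data.Nat.Base as ℕ using (ℕ; suc; NonZero)
open import Data.Nat.DivMod using (_mod_)
open import Data.Product.Base using (Σ; ∃; _×_; proj₁)
open import Data.Sum.Base using (_⊎_; inj₁; inj₂)
open import Data.Unit.Base using (⊤)
open import Function.Bundles using (Bijection; Injection; _↣_; _⇔_)
open import Function.Definitions using (Injective; Surjective)
open import Level using (0ℓ)
open import Relation.Binary.Bundles using (Setoid)
open import Relation.Binary.PropositionalEquality using (_≡_; setoid)
open import Relation.Nullary.Negation using (¬_)
import Relation.Binary.Construct.On as On

record Geometry : Set₁ where
  infix 4 _I_
  field
    Point : Set
    Line  : Set
    _I_   : Point → Line → Set

  Element : Set
  Element = Point ⊎ Line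

  -- The points on a line and the lines on a point. Proofs of incidence are
  -- not assumed unique, so equality compares the points (lines) only.
  pointsOn : Line → Setoid 0ℓ 0ℓ
  pointsOn l = On.setoid {B = ∃ λ p → p I l} (setoid Point) proj₁

  linesOn : Point → Setoid 0ℓ 0ℓ
  linesOn p = On.setoid {B = ∃ λ l → p I l} (setoid Line) proj₁

open Geometry using (Point; Line; Element; pointsOn; linesOn)

record Morphism (G H : Geometry) : Set where
  private
    module G = Geometry G
    module H = Geometry H
  field
    onPoints           : G.Point → H.Point
    onLines            : G.Line → H.Line
    preservesIncidence : ∀ {p l} → p G.I l → onPoints p H.I onLines l

record Epimorphism (G H : Geometry) : Set where
  field
    morphism : Morphism G H
  open Morphism morphism public
  field
    surjectiveOnPoints : Surjective _≡_ _≡_ onPoints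
    surjectiveOnLines  : Surjective _≡_ _≡_ onLines

-- A copy of K as a subgeometry of G; incidence in a subgeometry is the
-- restriction of incidence in G.
record Sub (K G : Geometry) : Set where
  private
    module K = Geometry K
    module G = Geometry G
  field
    point           : K.Point → G.Point
    line            : K.Line → G.Line
    point-injective : Injective _≡_ _≡_ point
    line-injective  : Injective _≡_ _≡_ line
    incidence       : ∀ p l → p K.I l ⇔ point p G.I line l

  Contains : G.Element → Set
  Contains (inj₁ p) = ∃ λ i → point i ≡ p
  Contains (inj₂ l) = ∃ λ j → line j ≡ l

-- Vertices and sides of a k-cycle: side j joins vertices j and j + 1 (mod k).
ordinaryGon : (k : ℕ) .{{_ : NonZero k}} → Geometry
ordinaryGon k = record
  { Point = Fin k
  ; Line  = Fin k
  ; _I_   = λ i j → i ≡ j ⊎ i ≡ suc (toℕ j) mod k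
  }

record IsWeakGeneralized4gon (G : Geometry) : Set where
  field
    -- The empty geometry satisfies the remaining axioms vacuously and is,
    -- as usual, not counted as a generalized polygon.
    nonempty      : Element G
    common4gon    : (x y : Element G) →
                    Σ (Sub (ordinaryGon 4) G) λ S → Sub.Contains S x × Sub.Contains S y
    noSubDigon    : ¬ Sub (ordinaryGon 2) G
    noSubTriangle : ¬ Sub (ordinaryGon 3) G

record IsThickGeneralizedQuadrangle (G : Geometry) : Set where
  field
    isWeakGeneralized4gon : IsWeakGeneralized4gon G
    ≥3-linesOn            : ∀ p → Injection (setoid (Fin 3)) (linesOn G p)
    ≥3-pointsOn           : ∀ l → Injection (setoid (Fin 3)) (pointsOn G l)

-- Order (u , v), where u and v are the cardinalities of U and V; the
-- cardinality of Maybe U is u + 1.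
record HasOrder (G : Geometry) (U V : Set) : Set where
  field
    pointsOn-size : ∀ l → Bijection (setoid (Maybe U)) (pointsOn G l)
    linesOn-size  : ∀ p → Bijection (setoid (Maybe V)) (linesOn G p)

-- As two points lie on at most one common line and every line has two points,
-- a generalized quadrangle has infinitely many elements iff it has infinitely
-- many points.
Infinite : Geometry → Set
Infinite G = ℕ ↣ Point G

data CountableCardinal : Set where
  finite : ℕ → CountableCardinal
  ℵ₀     : CountableCardinal

⟦_⟧ : CountableCardinal → Set
⟦ finite n ⟧ = Fin n
⟦ ℵ₀ ⟧       = ℕ

1<_ : CountableCardinal → Set
1< finite n = 1 ℕ.< n
1< ℵ₀       = ⊤

record IsGrid (s′ : CountableCardinal) (G : Geometry) : Set where
  field
    isWeakGeneralized4gon : IsWeakGeneralized4gon G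
    hasOrder              : HasOrder G ⟦ s′ ⟧ (Fin 1)

{-# OPTIONS --safe #-}
-- The quadrangle is a free one. Starting from isolated points and lines labelled
-- by Γ × ℕ, every pair (p , l) that is not yet at distance at most 3 is joined by
-- a new path p, ln p l, pt p l, l. Any map of the isolated elements to Γ extends
-- along such paths, because Γ itself has a path from any point to any line. A new
-- point has only two neighbours that are not younger, so the youngest point of a
-- digon or triangle would reveal a pair (p , l) joined although its distance was
-- already at most 3.
module Submission where

open import Defs
open import Data.Empty using (⊥; ⊥-elim; ⊥-elim-irr)
open import Data.Fin.Base using (Fin; suc; toℕ)
import Data.Fin.Properties as Fin
open import Data.Fin.Patterns using (0F; 1F; 2F; 3F)
open import Data.Maybe.Base using (Maybe; just; nothing)
import Data.Maybe.Properties as Maybe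
open import Data.Nat.Base using (ℕ; suc; _+_; _<_; _≤_; z≤n; s≤s)
open import Data.Nat.DivMod using (_mod_)
import Data.Nat.Properties as ℕ
open import Data.Product.Base using (Σ-syntax; ∃-syntax; _×_; _,_; proj₁; proj₂)
open import Data.Product.Properties using (≡-dec)
open import Data.Sum.Base using (_⊎_; inj₁; inj₂)
import Data.Sum.Properties as Sum
open import Data.Unit.Base using (⊤; tt)
open import Function.Base using (_∘_)
open import Function.Bundles using (Equivalence; mk⇔; mk↣)
open import Relation.Binary.Definitions using (DecidableEquality)
open import Relation.Binary.PropositionalEquality
  using (_≡_; _≢_; refl; sym; trans; cong; subst; ≢-sym)
open import Relation.Nullary.Decidable
  using (Dec; yes; no; map′; from-yes; _×-dec_; _⊎-dec_)
open import Relation.Nullary.Negation using (¬_; contradiction)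

-- Quadrangles from the projection axiom

-- Asking for two lines on a point and two points on a line, rather than three, lets grids satisfy
-- the same axioms as the free quadrangle. Decidability serves the case distinctions on coinciding
-- elements.
record IsQuadrangle (G : Geometry) : Set where
  open Geometry G
  field
    somePoint    : Point
    someLine     : Line
    _≟ₚ_         : DecidableEquality Point
    _≟ₗ_         : DecidableEquality Line
    _I?_         : ∀ p l → Dec (p I l)
    anotherLine  : ∀ p l → ∃[ m ] p I m × m ≢ l
    anotherPoint : ∀ l p → ∃[ q ] q I l × q ≢ p
    projection   : ∀ p l → ∃[ m ] ∃[ q ] p I m × q I m × q I l
    noDigon      : ∀ {p q l m} → p I l → q I l → p I m → q I m →
                   p ≢ q → l ≢ m → ⊥
    noTriangle   : ∀ {p q r l m n} → p I l → q I l → q I m → r I m → r I n → p I n →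
                   p ≢ q → q ≢ r → r ≢ p → l ≢ m → m ≢ n → n ≢ l → ⊥

-- Closed walks and paths in the incidence graph

next : Fin 4 → Fin 4
next j = suc (toℕ j) mod 4

-- The difference `i - j` modulo 4 is 0, 1, 2 or 3; the last case is written `j ≡ next i` so that it
-- can be matched by `refl`.
next-cases : ∀ i j → i ≡ j ⊎ i ≡ next j ⊎ i ≡ next (next j) ⊎ j ≡ next i
next-cases = from-yes (Fin.all? λ i → Fin.all? λ j →
  (i Fin.≟ j) ⊎-dec (i Fin.≟ next j) ⊎-dec (i Fin.≟ next (next j)) ⊎-dec (j Fin.≟ next i))

module _ {G : Geometry} (Q : IsQuadrangle G) where
  open Geometry G
  open IsQuadrangle Q

  -- Opposite vertices or sides that coincide, or a vertex on a side it does not bound, would make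
  -- two consecutive vertices share two consecutive sides, which `noDigon` excludes.
  closedWalk⇒4gon : (P : Fin 4 → Point) (L : Fin 4 → Line) →
    (∀ i → P i I L i) → (∀ i → P (next i) I L i) →
    (∀ i → P i ≢ P (next i)) → (∀ i → L i ≢ L (next i)) →
    Sub (ordinaryGon 4) G
  closedWalk⇒4gon P L start end P≢ L≢ = record
    { point           = P
    ; line            = L
    ; point-injective = λ {i} {j} → P-injective i j
    ; line-injective  = λ {i} {j} → L-injective i j
    ; incidence       = λ i j → mk⇔ (from i j) (to i j)
    }
    where
    P-opposite : ∀ i → P (next (next i)) ≢ P i
    P-opposite i e = noDigon (start i) (end i)
      (subst (_I L (next i)) e (end (next i))) (start (next i)) (P≢ i) (L≢ i)

    L-opposite : ∀ i → L (next (next i)) ≢ L i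
    L-opposite i e = noDigon (start (next i)) (end (next i))
      (end i) (subst (P (next (next i)) I_) e (start (next (next i))))
      (P≢ (next i)) (L≢ i ∘ sym)

    P-injective : ∀ i j → P i ≡ P j → i ≡ j
    P-injective i j e with next-cases i j
    ... | inj₁ i≡j                = i≡j
    ... | inj₂ (inj₁ refl)        = contradiction (sym e) (P≢ j)
    ... | inj₂ (inj₂ (inj₁ refl)) = contradiction e (P-opposite j)
    ... | inj₂ (inj₂ (inj₂ refl)) = contradiction e (P≢ i)

    L-injective : ∀ i j → L i ≡ L j → i ≡ j
    L-injective i j e with next-cases i j
    ... | inj₁ i≡j                = i≡j
    ... | inj₂ (inj₁ refl)        = contradiction (sym e) (L≢ j)
    ... | inj₂ (inj₂ (inj₁ refl)) = contradiction e (L-opposite j)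
    ... | inj₂ (inj₂ (inj₂ refl)) = contradiction e (L≢ i)

    from : ∀ i j → i ≡ j ⊎ i ≡ next j → P i I L j
    from i .i (inj₁ refl)        = start i
    from .(next j) j (inj₂ refl) = end j

    to : ∀ i j → P i I L j → i ≡ j ⊎ i ≡ next j
    to i j inc with next-cases i j
    ... | inj₁ i≡j                = inj₁ i≡j
    ... | inj₂ (inj₁ i≡j+1)       = inj₂ i≡j+1
    ... | inj₂ (inj₂ (inj₁ refl)) = ⊥-elim
      (noDigon (end j) inc (start (next j)) (end (next j)) (P≢ (next j)) (L≢ j))
    ... | inj₂ (inj₂ (inj₂ refl)) = ⊥-elim
      (noDigon (start i) (end i) inc (start (next i)) (P≢ i) (L≢ i))

  -- A path of length 5 in the incidence graph, without backtracking. A path of length 3 from `r` to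
  -- `k`, given by `projection`, will close it to a circuit of length 8.
  record Path (k : Line) (p : Point) (l : Line) (q : Point) (m : Line) (r : Point) : Set where
    field
      p-k : p I k
      p-l : p I l
      q-l : q I l
      q-m : q I m
      r-m : r I m
      k≢l : k ≢ l
      p≢q : p ≢ q
      l≢m : l ≢ m
      q≢r : q ≢ r

  -- Otherwise `k`, `l`, `m` would be the sides of a triangle; `noDigon` supplies the two
  -- inequalities that the path does not state.
  path-ends : ∀ {k p l q m r} → Path k p l q m r → ¬ r I k
  path-ends {k} {p} {l} {q} {m} {r} π r-k =
    noTriangle p-l q-l q-m r-m r-k p-k p≢q q≢r r≢p l≢m m≢k k≢l
    where
    open Path π
    r≢p : r ≢ p
    r≢p refl = noDigon p-l q-l r-m q-m p≢q l≢m
    m≢k : m ≢ k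
    m≢k refl = noDigon p-l q-l p-k q-m p≢q l≢m

  record On4gon (k : Line) (p : Point) (l : Line) (q : Point) (m : Line) (r : Point) : Set where
    field
      gon : Sub (ordinaryGon 4) G
    open Sub gon public
    field
      k∈ : Contains (inj₂ k)
      p∈ : Contains (inj₁ p)
      l∈ : Contains (inj₂ l)
      q∈ : Contains (inj₁ q)
      m∈ : Contains (inj₂ m)
      r∈ : Contains (inj₁ r)

  path⇒4gon : ∀ {k p l q m r} → Path k p l q m r → On4gon k p l q m r
  path⇒4gon {k} {p} {l} {q} {m} {r} π with projection r k
  ... | n , s , r-n , s-n , s-k = record
    { gon = closedWalk⇒4gon P L
        (λ { 0F → p-l ; 1F → q-m ; 2F → r-n ; 3F → s-k })
        (λ { 0F → q-l ; 1F → r-m ; 2F → s-n ; 3F → p-k })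
        (λ { 0F → p≢q ; 1F → q≢r ; 2F → r≢s ; 3F → s≢p })
        (λ { 0F → l≢m ; 1F → m≢n ; 2F → n≢k ; 3F → k≢l })
    ; k∈ = 3F , refl
    ; p∈ = 0F , refl
    ; l∈ = 0F , refl
    ; q∈ = 1F , refl
    ; m∈ = 1F , refl
    ; r∈ = 2F , refl
    }
    where
    open Path π
    P : Fin 4 → Point
    P 0F = p
    P 1F = q
    P 2F = r
    P 3F = s
    L : Fin 4 → Line
    L 0F = l
    L 1F = m
    L 2F = n
    L 3F = k
    n≢k : n ≢ k
    n≢k refl = path-ends π r-n
    r≢s : r ≢ s
    r≢s refl = path-ends π s-k
    q≢s : q ≢ s
    q≢s refl = noDigon p-k s-k p-l q-l p≢q k≢l
    m≢n : m ≢ n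
    -- If `n` were `m`, then `s` could replace `r` at the end of the path.
    m≢n refl = path-ends (record { Path π hiding (r-m; q≢r) ; r-m = s-n ; q≢r = q≢s }) s-k
    n≢l : n ≢ l
    n≢l refl = noDigon q-l r-n q-m r-m q≢r l≢m
    s≢p : s ≢ p
    -- If `s` were `p`, then `n` could replace `k` at the start of the path.
    s≢p refl = path-ends (record { Path π hiding (p-k; k≢l) ; p-k = s-n ; k≢l = n≢l }) r-n

  flag-path : ∀ {p l} → p I l → ∃[ k ] ∃[ q ] ∃[ m ] ∃[ r ] Path k p l q m r
  flag-path {p} {l} p-l =
    let k , p-k , k≢l = anotherLine p l
        q , q-l , q≢p = anotherPoint l p
        m , q-m , m≢l = anotherLine q l
        r , r-m , r≢q = anotherPoint m q
    in k , q , m , r , record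
      { p-k = p-k ; p-l = p-l ; q-l = q-l ; q-m = q-m ; r-m = r-m
      ; k≢l = k≢l ; p≢q = ≢-sym q≢p ; l≢m = ≢-sym m≢l ; q≢r = ≢-sym r≢q }

  -- Common 4-gons of any two elements

  Common : Element → Element → Set
  Common x y = Σ[ S ∈ Sub (ordinaryGon 4) G ] Sub.Contains S x × Sub.Contains S y

  common-pointLine : ∀ p l → Common (inj₁ p) (inj₂ l)
  common-pointLine p l with p I? l
  ... | yes p-l =
    let _ , _ , _ , _ , π = flag-path p-l
        open On4gon (path⇒4gon π)
    in gon , p∈ , l∈
  ... | no ¬p-l =
    let m , q , p-m , q-m , q-l = projection p l
        k , p-k , k≢m = anotherLine p m
        r , r-l , r≢q = anotherPoint l q
        π : Path k p m q l r
        π = record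
          { p-k = p-k ; p-l = p-m ; q-l = q-m ; q-m = q-l ; r-m = r-l ; k≢l = k≢m
          ; p≢q = λ p≡q → ¬p-l (subst (_I l) (sym p≡q) q-l)
          ; l≢m = λ m≡l → ¬p-l (subst (p I_) m≡l p-m)
          ; q≢r = ≢-sym r≢q }
        open On4gon (path⇒4gon π)
    in gon , p∈ , m∈

  common-collinear : ∀ {p q l} → p I l → q I l → p ≢ q → Common (inj₁ p) (inj₁ q)
  common-collinear {p} {q} {l} p-l q-l p≢q =
    let k , p-k , k≢l = anotherLine p l
        m , q-m , m≢l = anotherLine q l
        r , r-m , r≢q = anotherPoint m q
        π : Path k p l q m r
        π = record
          { p-k = p-k ; p-l = p-l ; q-l = q-l ; q-m = q-m ; r-m = r-m
          ; k≢l = k≢l ; p≢q = p≢q ; l≢m = ≢-sym m≢l ; q≢r = ≢-sym r≢q }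
        open On4gon (path⇒4gon π)
    in gon , p∈ , q∈

  -- Projecting `p` onto a line `m` through `q` gives a walk `p, l, r, m, q`, which is prolonged by
  -- a line before `p`. If the walk is degenerate, `p` and `q` are collinear.
  common-pointPoint : ∀ p q → Common (inj₁ p) (inj₁ q)
  common-pointPoint p q with p ≟ₚ q
  ... | yes refl =
    let _ , p-l , _ = anotherLine p someLine
        _ , _ , _ , _ , π = flag-path p-l
        open On4gon (path⇒4gon π)
    in gon , p∈ , p∈
  ... | no p≢q with anotherLine q someLine
  ...   | m , q-m , _ with projection p m
  ...     | l , r , p-l , r-l , r-m with r ≟ₚ p | r ≟ₚ q | l ≟ₗ m
  ...       | yes refl | _        | _        = common-collinear r-m q-m p≢q
  ...       | no _     | yes refl | _        = common-collinear p-l r-l p≢q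
  ...       | no _     | no _     | yes refl = common-collinear p-l q-m p≢q
  ...       | no r≢p   | no r≢q   | no l≢m   =
    let k , p-k , k≢l = anotherLine p l
        π : Path k p l r m q
        π = record
          { p-k = p-k ; p-l = p-l ; q-l = r-l ; q-m = r-m ; r-m = q-m
          ; k≢l = k≢l ; p≢q = ≢-sym r≢p ; l≢m = l≢m ; q≢r = r≢q }
        open On4gon (path⇒4gon π)
    in gon , p∈ , r∈

  common-concurrent : ∀ {p l m} → p I l → p I m → l ≢ m → Common (inj₂ l) (inj₂ m)
  common-concurrent {p} {l} {m} p-l p-m l≢m =
    let q , q-m , q≢p = anotherPoint m p
        n , q-n , n≢m = anotherLine q m
        r , r-n , r≢q = anotherPoint n q
        π : Path l p m q n r
        π = record
          { p-k = p-l ; p-l = p-m ; q-l = q-m ; q-m = q-n ; r-m = r-n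
          ; k≢l = l≢m ; p≢q = ≢-sym q≢p ; l≢m = ≢-sym n≢m ; q≢r = ≢-sym r≢q }
        open On4gon (path⇒4gon π)
    in gon , k∈ , l∈

  -- Dual to the case of two points, except that a `Path` starts with a line, so the walk
  -- `l, p, n, q, m` is prolonged by a point at its end.
  common-lineLine : ∀ l m → Common (inj₂ l) (inj₂ m)
  common-lineLine l m with l ≟ₗ m
  ... | yes refl =
    let _ , p-l , _ = anotherPoint l somePoint
        _ , _ , _ , _ , π = flag-path p-l
        open On4gon (path⇒4gon π)
    in gon , l∈ , l∈
  ... | no l≢m with anotherPoint l somePoint
  ...   | p , p-l , _ with projection p m
  ...     | n , q , p-n , q-n , q-m with n ≟ₗ l | n ≟ₗ m | p ≟ₚ q
  ...       | yes refl | _        | _        = common-concurrent q-n q-m l≢m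
  ...       | no _     | yes refl | _        = common-concurrent p-l p-n l≢m
  ...       | no _     | no _     | yes refl = common-concurrent p-l q-m l≢m
  ...       | no n≢l   | no n≢m   | no p≢q   =
    let r , r-m , r≢q = anotherPoint m q
        π : Path l p n q m r
        π = record
          { p-k = p-l ; p-l = p-n ; q-l = q-n ; q-m = q-m ; r-m = r-m
          ; k≢l = ≢-sym n≢l ; p≢q = p≢q ; l≢m = n≢m ; q≢r = ≢-sym r≢q }
        open On4gon (path⇒4gon π)
    in gon , k∈ , m∈

  common : ∀ x y → Common x y
  common (inj₁ p) (inj₁ q) = common-pointPoint p q
  common (inj₁ p) (inj₂ l) = common-pointLine p l
  common (inj₂ l) (inj₁ p) = let S , p∈ , l∈ = common-pointLine p l in S , l∈ , p∈
  common (inj₂ l) (inj₂ m) = common-lineLine l m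

  isQuadrangle⇒isWeakGeneralized4gon : IsWeakGeneralized4gon G
  isQuadrangle⇒isWeakGeneralized4gon = record
    { nonempty      = inj₁ somePoint
    ; common4gon    = common
    ; noSubDigon    = λ S →
        let open Sub S
            I-point : ∀ {i j} → i ≡ j ⊎ i ≡ suc (toℕ j) mod 2 → point i I line j
            I-point {i} {j} = Equivalence.to (incidence i j)
        in noDigon {point 0F} {point 1F} {line 0F} {line 1F}
             (I-point (inj₁ refl)) (I-point (inj₂ refl)) (I-point (inj₂ refl)) (I-point (inj₁ refl))
             (λ e → Fin.0≢1+n (point-injective e)) (λ e → Fin.0≢1+n (line-injective e))
    ; noSubTriangle = λ S →
        let open Sub S
            I-point : ∀ {i j} → i ≡ j ⊎ i ≡ suc (toℕ j) mod 3 → point i I line j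
            I-point {i} {j} = Equivalence.to (incidence i j)
            point≢ : ∀ {i j} → i ≢ j → point i ≢ point j
            point≢ i≢j e = i≢j (point-injective e)
            line≢ : ∀ {i j} → i ≢ j → line i ≢ line j
            line≢ i≢j e = i≢j (line-injective e)
        in noTriangle {point 0F} {point 1F} {point 2F} {line 0F} {line 1F} {line 2F}
             (I-point (inj₁ refl)) (I-point (inj₂ refl)) (I-point (inj₁ refl))
             (I-point (inj₂ refl)) (I-point (inj₁ refl)) (I-point (inj₂ refl))
             (point≢ λ ()) (point≢ λ ()) (point≢ λ ()) (line≢ λ ()) (line≢ λ ()) (line≢ λ ())
    }

-- Free quadrangles

module Free {P L : Set} (_≟P_ : DecidableEquality P) (_≟L_ : DecidableEquality L) where

  -- Raw elements: for any p and l, including pairs that must not be joined.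
  data Pt : Set
  data Ln : Set

  data Pt where
    base : P → ℕ → Pt
    pt   : Pt → Ln → Pt

  data Ln where
    base : L → ℕ → Ln
    ln   : Pt → Ln → Ln

  infix 4 _≟ₚ_ _≟ₗ_ _⇘_ _⇗_ _I_

  _≟ₚ_ : DecidableEquality Pt
  _≟ₗ_ : DecidableEquality Ln

  base x m ≟ₚ base y n = map′ (λ { (refl , refl) → refl }) (λ { refl → refl , refl })
                              ((x ≟P y) ×-dec (m ℕ.≟ n))
  base _ _ ≟ₚ pt _ _   = no λ ()
  pt _ _   ≟ₚ base _ _ = no λ ()
  pt p l   ≟ₚ pt q m   = map′ (λ { (refl , refl) → refl }) (λ { refl → refl , refl })
                              ((p ≟ₚ q) ×-dec (l ≟ₗ m))

  base x m ≟ₗ base y n = map′ (λ { (refl , refl) → refl }) (λ { refl → refl , refl })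
                              ((x ≟L y) ×-dec (m ℕ.≟ n))
  base _ _ ≟ₗ ln _ _   = no λ ()
  ln _ _   ≟ₗ base _ _ = no λ ()
  ln p l   ≟ₗ ln q m   = map′ (λ { (refl , refl) → refl }) (λ { refl → refl , refl })
                              ((p ≟ₚ q) ×-dec (l ≟ₗ m))

  -- p ⇘ l (l ⇗ p): l is incident with p and was created no later than p (and
  -- dually). Twins ln p l and pt p l are created together.
  data _⇘_ : Pt → Ln → Set where
    parent : ∀ {p l} → pt p l ⇘ l
    twin   : ∀ {p l} → pt p l ⇘ ln p l

  data _⇗_ : Ln → Pt → Set where
    parent : ∀ {p l} → ln p l ⇗ p
    twin   : ∀ {p l} → ln p l ⇗ pt p l

  _I_ : Pt → Ln → Set
  p I l = p ⇘ l ⊎ l ⇗ p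

  -- A base point has no `⇘`-neighbour and any other point exactly two, so the search is finite.
  any⇘? : ∀ p {Q : Ln → Set} → (∀ l → Dec (Q l)) → Dec (∃[ l ] p ⇘ l × Q l)
  any⇘? (base _ _) Q? = no λ ()
  any⇘? (pt p l)   Q? = map′
    (λ { (inj₁ x) → l , parent , x ; (inj₂ x) → ln p l , twin , x })
    (λ { (_ , parent , x) → inj₁ x ; (_ , twin , x) → inj₂ x })
    (Q? l ⊎-dec Q? (ln p l))

  any⇗? : ∀ l {Q : Pt → Set} → (∀ p → Dec (Q p)) → Dec (∃[ p ] l ⇗ p × Q p)
  any⇗? (base _ _) Q? = no λ ()
  any⇗? (ln p l)   Q? = map′
    (λ { (inj₁ x) → p , parent , x ; (inj₂ x) → pt p l , twin , x })
    (λ { (_ , parent , x) → inj₁ x ; (_ , twin , x) → inj₂ x })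
    (Q? p ⊎-dec Q? (pt p l))

  _I?_ : ∀ p l → Dec (p I l)
  p I? l =
    map′ (λ { (_ , d , refl) → d }) (λ d → _ , d , refl) (any⇘? p (_≟ₗ l))
    ⊎-dec
    map′ (λ { (_ , d , refl) → d }) (λ d → _ , d , refl) (any⇗? l (_≟ₚ p))

  -- The ways in which p and l can be at distance at most 3 without the path
  -- p, ln p l, pt p l, l (see path⇒near). All searches are finite.
  Near : Pt → Ln → Set
  Near p l =
    p I l
    ⊎ (∃[ m ] p ⇘ m × ∃[ q ] l ⇗ q × q I m)
    ⊎ (∃[ m ] p ⇘ m × ∃[ q ] m ⇗ q × q I l)
    ⊎ (∃[ q ] l ⇗ q × ∃[ m ] q ⇘ m × p I m)

  near? : ∀ p l → Dec (Near p l)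
  near? p l =
    (p I? l)
    ⊎-dec any⇘? p (λ m → any⇗? l (_I? m))
    ⊎-dec any⇘? p (λ m → any⇗? m (_I? l))
    ⊎-dec any⇗? l (λ q → any⇘? q (p I?_))

  -- Only `q ⇘ m` together with `q ⇘ l` needs an argument: then `m` and `l` coincide or one of them
  -- is the twin of `q`, which is also related to `q` by `⇗`.
  ⇘-path⇒near : ∀ {p m q l} → p ⇘ m → q I m → q I l → Near p l
  ⇘-path⇒near p⇘m q-m           (inj₂ l⇗q)    = inj₂ (inj₁ (_ , p⇘m , _ , l⇗q , q-m))
  ⇘-path⇒near p⇘m (inj₂ m⇗q)    q-l           = inj₂ (inj₂ (inj₁ (_ , p⇘m , _ , m⇗q , q-l)))
  ⇘-path⇒near p⇘m (inj₁ parent) (inj₁ parent) = inj₁ (inj₁ p⇘m)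
  ⇘-path⇒near p⇘m (inj₁ parent) (inj₁ twin)   = inj₂ (inj₁ (_ , p⇘m , _ , twin , inj₁ parent))
  ⇘-path⇒near p⇘m (inj₁ twin)   q-l           = inj₂ (inj₂ (inj₁ (_ , p⇘m , _ , twin , q-l)))

  ⇗-path⇒near : ∀ {p m q l} → p I m → q I m → l ⇗ q → Near p l
  ⇗-path⇒near p-m           (inj₁ q⇘m)    l⇗q = inj₂ (inj₂ (inj₂ (_ , l⇗q , _ , q⇘m , p-m)))
  ⇗-path⇒near p-m           (inj₂ twin)   l⇗q = inj₂ (inj₂ (inj₂ (_ , l⇗q , _ , twin , p-m)))
  ⇗-path⇒near (inj₁ p⇘m)    (inj₂ parent) l⇗q = ⇘-path⇒near p⇘m (inj₂ parent) (inj₂ l⇗q)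
  ⇗-path⇒near (inj₂ twin)   (inj₂ parent) l⇗q = ⇘-path⇒near twin (inj₂ parent) (inj₂ l⇗q)
  ⇗-path⇒near (inj₂ parent) (inj₂ parent) l⇗q = inj₁ (inj₂ l⇗q)

  -- Outside the scope of the two lemmas above, `p` is a parent of `m` and `l` a parent of `q`. Then
  -- the path degenerates to `p I l`, or `m` and `q` are the twins created for `p` and `l`.
  path⇒near : ∀ {p m q l} → p I m → q I m → q I l → Near p l ⊎ m ≡ ln p l
  path⇒near (inj₁ p⇘m)    q-m           q-l           = inj₁ (⇘-path⇒near p⇘m q-m q-l)
  path⇒near (inj₂ twin)   q-m           q-l           = inj₁ (⇘-path⇒near twin q-m q-l)
  path⇒near p-m           q-m           (inj₂ l⇗q)    = inj₁ (⇗-path⇒near p-m q-m l⇗q)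
  path⇒near p-m           q-m           (inj₁ twin)   = inj₁ (⇗-path⇒near p-m q-m twin)
  path⇒near (inj₂ parent) (inj₂ parent) q-l           = inj₁ (inj₁ q-l)
  path⇒near p-m           (inj₁ parent) (inj₁ parent) = inj₁ (inj₁ p-m)
  path⇒near (inj₂ parent) (inj₂ twin)   (inj₁ parent) = inj₂ refl
  path⇒near (inj₂ parent) (inj₁ twin)   (inj₁ parent) = inj₂ refl

  -- A recursive predicate on raw elements takes the place of a union of stages: every pair joined
  -- in the history of an element must fail `Near`, which inspects only elements reached from the
  -- pair by `⇘` and `⇗`.
  Validₚ : Pt → Set
  Validₗ : Ln → Set
  Joinable : Pt → Ln → Set

  Validₚ (base _ _) = ⊤
  Validₚ (pt p l)   = Joinable p l

  Validₗ (base _ _) = ⊤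
  Validₗ (ln p l)   = Joinable p l

  Joinable p l = Validₚ p × Validₗ l × ¬ Near p l

  -- Together with `valid-⇗`, this makes the witnesses of `Near p l` valid whenever `p` and `l` are.
  valid-⇘ : ∀ {p l} → p ⇘ l → Validₚ p → Validₗ l
  valid-⇘ parent (_ , v , _) = v
  valid-⇘ twin   v           = v

  valid-⇗ : ∀ {p l} → l ⇗ p → Validₗ l → Validₚ p
  valid-⇗ parent (v , _) = v
  valid-⇗ twin   v       = v

  -- Since `valid` is irrelevant, equality of points is equality of raw points and stays decidable.
  record Point′ : Set where
    constructor ⟨_⟩
    field
      raw    : Pt
      .{valid} : Validₚ raw
  open Point′

  record Line′ : Set where
    constructor ⟨_⟩
    field
      raw    : Ln
      .{valid} : Validₗ raw
  open Line′

  geometry : Geometry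
  geometry = record { Point = Point′ ; Line = Line′ ; _I_ = λ p l → raw p I raw l }

  module A = Geometry geometry

  raw-injectiveₚ : ∀ {p q : Point′} → raw p ≡ raw q → p ≡ q
  raw-injectiveₚ refl = refl

  raw-injectiveₗ : ∀ {l m : Line′} → raw l ≡ raw m → l ≡ m
  raw-injectiveₗ refl = refl

  projection : ∀ p l → ∃[ m ] ∃[ q ] p A.I m × q A.I m × q A.I l
  projection (⟨ p ⟩ {v}) (⟨ l ⟩ {w}) with near? p l
  ... | no ¬near =
    ⟨ ln p l ⟩ {v , w , ¬near} , ⟨ pt p l ⟩ {v , w , ¬near} ,
    inj₂ parent , inj₁ twin , inj₁ parent
  ... | yes (inj₁ p-l) = ⟨ l ⟩ {w} , ⟨ p ⟩ {v} , p-l , p-l , p-l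
  ... | yes (inj₂ (inj₁ (m , p⇘m , q , l⇗q , q-m))) =
    ⟨ m ⟩ {valid-⇘ p⇘m v} , ⟨ q ⟩ {valid-⇗ l⇗q w} , inj₁ p⇘m , q-m , inj₂ l⇗q
  ... | yes (inj₂ (inj₂ (inj₁ (m , p⇘m , q , m⇗q , q-l)))) =
    ⟨ m ⟩ {valid-⇘ p⇘m v} , ⟨ q ⟩ {valid-⇗ m⇗q (valid-⇘ p⇘m v)} , inj₁ p⇘m , inj₂ m⇗q , q-l
  ... | yes (inj₂ (inj₂ (inj₂ (q , l⇗q , m , q⇘m , p-m)))) =
    ⟨ m ⟩ {valid-⇘ q⇘m (valid-⇗ l⇗q w)} , ⟨ q ⟩ {valid-⇗ l⇗q w} , p-m , inj₁ q⇘m , inj₂ l⇗q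

  -- A linearisation of the order of creation in which ln p l precedes its twin
  -- and which makes base elements with a large index young.
  ageₚ : Pt → ℕ
  ageₗ : Ln → ℕ

  ageₚ (base _ n) = n
  ageₚ (pt p l)   = suc (suc (ageₚ p + ageₗ l))

  ageₗ (base _ n) = n
  ageₗ (ln p l)   = suc (ageₚ p + ageₗ l)

  ⇘-age : ∀ {p l} → p ⇘ l → ageₗ l < ageₚ p
  ⇘-age (parent {p} {l}) = ℕ.m≤n⇒m≤1+n (s≤s (ℕ.m≤n+m (ageₗ l) (ageₚ p)))
  ⇘-age twin             = ℕ.n<1+n _

  ⇗-age : ∀ {l p} → l ⇗ p → ageₚ p ≤ suc (ageₗ l)
  ⇗-age (parent {p} {l}) = ℕ.m≤n⇒m≤1+n (ℕ.m≤n⇒m≤1+n (ℕ.m≤m+n (ageₚ p) (ageₗ l)))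
  ⇗-age twin             = ℕ.≤-refl

  -- If `p ⇘ l` fails, then `l` is some `ln p a`, and every other point on it is its twin or was
  -- created from it later, hence is younger than `p`.
  line-older : ∀ {p q l} → p I l → q I l → p ≢ q → ageₚ q ≤ ageₚ p → p ⇘ l
  line-older (inj₁ p⇘l)    _             _   _   = p⇘l
  line-older (inj₂ twin)   _             _   _   = twin
  line-older (inj₂ parent) (inj₂ parent) p≢q _   = contradiction refl p≢q
  line-older (inj₂ (parent {p} {a})) (inj₁ q⇘l) _ q≤p =
    contradiction (ℕ.<-trans (s≤s (ℕ.m≤m+n (ageₚ p) (ageₗ a))) (⇘-age q⇘l)) (ℕ.≤⇒≯ q≤p)
  -- Twins are related both ways; the `⇘` proof reduces this to the preceding clause.
  line-older (inj₂ parent) (inj₂ twin) p≢q q≤p = line-older (inj₂ parent) (inj₁ twin) p≢q q≤p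

  -- Besides `p` and the twin, a point on `ln p l` has that line as parent, and so is younger than
  -- the twin.
  older-on-twin : ∀ {p l q} → q I ln p l → pt p l ≢ q → ageₚ q ≤ ageₚ (pt p l) → q ≡ p
  older-on-twin (inj₂ parent) _ _   = refl
  older-on-twin (inj₁ twin)   ≢ _   = contradiction refl ≢
  older-on-twin (inj₂ twin)   ≢ _   = contradiction refl ≢
  older-on-twin (inj₁ (parent {q})) _ q≤p =
    contradiction (s≤s (s≤s (ℕ.m≤n+m _ (ageₚ q)))) (ℕ.≤⇒≯ q≤p)

  -- Absence of digons and triangles

  private
    -- By `line-older` the two lines are the parent and the twin of the youngest point `p`. As a
    -- point on the twin, `q` is the parent point, so the two parents of `p` are incident, against
    -- validity.
    noDigon-youngest : ∀ {p q l m} → .(Validₚ p) → p I l → q I l → p I m → q I m →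
      p ≢ q → l ≢ m → ageₚ q ≤ ageₚ p → ⊥
    noDigon-youngest v p-l q-l p-m q-m p≢q l≢m q≤p
      with line-older p-l q-l p≢q q≤p | line-older p-m q-m p≢q q≤p
    ... | parent | parent = l≢m refl
    ... | twin   | twin   = l≢m refl
    ... | parent | twin   with older-on-twin q-m p≢q q≤p
    ...   | refl = ⊥-elim-irr (proj₂ (proj₂ v) (inj₁ q-l))
    noDigon-youngest v p-l q-l p-m q-m p≢q l≢m q≤p
        | twin   | parent with older-on-twin q-l p≢q q≤p
    ...   | refl = ⊥-elim-irr (proj₂ (proj₂ v) (inj₁ q-m))

    -- As for digons, one of `q` and `r` is the parent point of `p` and the other lies on the parent
    -- line. The rest of the triangle is a path between the parents, so they are near unless `m` is
    -- the twin of `p`, which is another side.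
    noTriangle-youngest : ∀ {p q r l m n} → .(Validₚ p) →
      p I l → q I l → q I m → r I m → r I n → p I n →
      p ≢ q → r ≢ p → l ≢ m → m ≢ n → n ≢ l →
      ageₚ q ≤ ageₚ p → ageₚ r ≤ ageₚ p → ⊥
    noTriangle-youngest v p-l q-l q-m r-m r-n p-n p≢q r≢p l≢m m≢n n≢l q≤p r≤p
      with line-older p-l q-l p≢q q≤p | line-older p-n r-n (≢-sym r≢p) r≤p
    ... | parent | parent = n≢l refl
    ... | twin   | twin   = n≢l refl
    ... | parent | twin   with older-on-twin r-n (≢-sym r≢p) r≤p
    ...   | refl with path⇒near r-m q-m q-l
    ...     | inj₁ near = ⊥-elim-irr (proj₂ (proj₂ v) near)
    ...     | inj₂ m≡n  = m≢n m≡n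
    noTriangle-youngest v p-l q-l q-m r-m r-n p-n p≢q r≢p l≢m m≢n n≢l q≤p r≤p
        | twin   | parent with older-on-twin q-l p≢q q≤p
    ...   | refl with path⇒near q-m r-m r-n
    ...     | inj₁ near = ⊥-elim-irr (proj₂ (proj₂ v) near)
    ...     | inj₂ m≡l  = l≢m (sym m≡l)

  noDigon : ∀ {p q l m} → p A.I l → q A.I l → p A.I m → q A.I m → p ≢ q → l ≢ m → ⊥
  noDigon {⟨ p ⟩ {v}} {⟨ q ⟩ {w}} p-l q-l p-m q-m p≢q l≢m
    with ℕ.≤-total (ageₚ q) (ageₚ p)
  ... | inj₁ q≤p = noDigon-youngest v p-l q-l p-m q-m
                     (p≢q ∘ raw-injectiveₚ) (l≢m ∘ raw-injectiveₗ) q≤p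
  ... | inj₂ p≤q = noDigon-youngest w q-l p-l q-m p-m
                     (≢-sym p≢q ∘ raw-injectiveₚ) (l≢m ∘ raw-injectiveₗ) p≤q

  noTriangle : ∀ {p q r l m n} →
    p A.I l → q A.I l → q A.I m → r A.I m → r A.I n → p A.I n →
    p ≢ q → q ≢ r → r ≢ p → l ≢ m → m ≢ n → n ≢ l → ⊥
  noTriangle {⟨ p ⟩ {u}} {⟨ q ⟩ {v}} {⟨ r ⟩ {w}}
             p-l q-l q-m r-m r-n p-n p≢q q≢r r≢p l≢m m≢n n≢l =
    youngest (ℕ.≤-total (ageₚ q) (ageₚ p)) (ℕ.≤-total (ageₚ r) (ageₚ q)) (ℕ.≤-total (ageₚ p) (ageₚ r))
    where
    p-youngest : ageₚ q ≤ ageₚ p → ageₚ r ≤ ageₚ p → ⊥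
    p-youngest = noTriangle-youngest u p-l q-l q-m r-m r-n p-n
      (p≢q ∘ raw-injectiveₚ) (r≢p ∘ raw-injectiveₚ)
      (l≢m ∘ raw-injectiveₗ) (m≢n ∘ raw-injectiveₗ) (n≢l ∘ raw-injectiveₗ)
    q-youngest : ageₚ r ≤ ageₚ q → ageₚ p ≤ ageₚ q → ⊥
    q-youngest = noTriangle-youngest v q-m r-m r-n p-n p-l q-l
      (q≢r ∘ raw-injectiveₚ) (p≢q ∘ raw-injectiveₚ)
      (m≢n ∘ raw-injectiveₗ) (n≢l ∘ raw-injectiveₗ) (l≢m ∘ raw-injectiveₗ)
    r-youngest : ageₚ p ≤ ageₚ r → ageₚ q ≤ ageₚ r → ⊥
    r-youngest = noTriangle-youngest w r-n p-n p-l q-l q-m r-m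
      (r≢p ∘ raw-injectiveₚ) (q≢r ∘ raw-injectiveₚ)
      (n≢l ∘ raw-injectiveₗ) (l≢m ∘ raw-injectiveₗ) (m≢n ∘ raw-injectiveₗ)
    youngest : ageₚ q ≤ ageₚ p ⊎ ageₚ p ≤ ageₚ q → ageₚ r ≤ ageₚ q ⊎ ageₚ q ≤ ageₚ r →
               ageₚ p ≤ ageₚ r ⊎ ageₚ r ≤ ageₚ p → ⊥
    youngest (inj₁ q≤p) _          (inj₂ r≤p) = p-youngest q≤p r≤p
    youngest (inj₂ p≤q) (inj₁ r≤q) _          = q-youngest r≤q p≤q
    youngest _          (inj₂ q≤r) (inj₁ p≤r) = r-youngest p≤r q≤r
    youngest (inj₁ q≤p) (inj₁ r≤q) (inj₁ _)   = p-youngest q≤p (ℕ.≤-trans r≤q q≤p)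
    youngest (inj₂ p≤q) (inj₂ q≤r) (inj₂ _)   = r-youngest (ℕ.≤-trans p≤q q≤r) q≤r

  -- A base line has no `⇗`-neighbour, so it could only be a `⇘`-neighbour of `p` or of a point
  -- reached from `p` by `⇘` and `⇗`. Such a point has age at most `suc (ageₚ p)`, too small for
  -- `n`.
  ¬near-freshLine : ∀ {p y n} → suc (ageₚ p) < n → ¬ Near p (base y n)
  ¬near-freshLine p<n (inj₁ (inj₁ p⇘l)) =
    ℕ.<-asym (⇘-age p⇘l) (ℕ.<-trans (ℕ.n<1+n _) p<n)
  ¬near-freshLine p<n (inj₂ (inj₂ (inj₁ (m , p⇘m , q , m⇗q , inj₁ q⇘l)))) =
    ℕ.<-irrefl refl (ℕ.<-trans p<n (ℕ.<-≤-trans (⇘-age q⇘l)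
      (ℕ.≤-trans (⇗-age m⇗q) (ℕ.m≤n⇒m≤1+n (⇘-age p⇘m)))))

  -- Dual; the margin of one allows for the twin of `l`, whose age is `suc (ageₗ l)`.
  ¬near-freshPoint : ∀ {x n l} → suc (ageₗ l) < n → ¬ Near (base x n) l
  ¬near-freshPoint l<n (inj₁ (inj₂ l⇗p)) =
    ℕ.<-irrefl refl (ℕ.≤-<-trans (⇗-age l⇗p) l<n)
  ¬near-freshPoint l<n (inj₂ (inj₂ (inj₂ (q , l⇗q , m , q⇘m , inj₂ m⇗p)))) =
    ℕ.<-irrefl refl (ℕ.<-≤-trans l<n (ℕ.≤-trans (⇗-age m⇗p)
      (ℕ.≤-trans (⇘-age q⇘m) (⇗-age l⇗q))))

  -- Thickness and infinitude

  module Thick (x₀ : P) (y₀ : L) where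

    newLine : Point′ → ℕ → Line′
    newLine (⟨ p ⟩ {v}) i =
      -- The index exceeds `suc (ageₚ p)`, as `¬near-freshLine` requires, and varies with `i`, so
      -- that one point gets infinitely many lines.
      ⟨ ln p (base y₀ (2 + i + ageₚ p)) ⟩
        {v , tt , ¬near-freshLine (s≤s (s≤s (ℕ.m≤n+m (ageₚ p) i)))}

    newPoint : Line′ → ℕ → Point′
    newPoint (⟨ l ⟩ {v}) i =
      ⟨ pt (base x₀ (2 + i + ageₗ l)) l ⟩
        {tt , v , ¬near-freshPoint (s≤s (s≤s (ℕ.m≤n+m (ageₗ l) i)))}

    newLine-injective : ∀ p {i j} → newLine p i ≡ newLine p j → i ≡ j
    newLine-injective p {i} {j} e = ℕ.+-cancelʳ-≡ (ageₚ (raw p)) i j (index (cong raw e))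
      where
      index : ∀ {q m n} → ln q (base y₀ (2 + m)) ≡ ln q (base y₀ (2 + n)) → m ≡ n
      index refl = refl

    newPoint-injective : ∀ l {i j} → newPoint l i ≡ newPoint l j → i ≡ j
    newPoint-injective l {i} {j} e = ℕ.+-cancelʳ-≡ (ageₗ (raw l)) i j (index (cong raw e))
      where
      index : ∀ {m q n} → pt (base x₀ (2 + m)) q ≡ pt (base x₀ (2 + n)) q → m ≡ n
      index refl = refl

    _≟A_ : DecidableEquality A.Point
    p ≟A q = map′ raw-injectiveₚ (cong raw) (raw p ≟ₚ raw q)

    _≟B_ : DecidableEquality A.Line
    l ≟B m = map′ raw-injectiveₗ (cong raw) (raw l ≟ₗ raw m)

    anotherLine : ∀ p l → ∃[ m ] p A.I m × m ≢ l
    anotherLine p l with newLine p 0 ≟B l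
    ... | no  ≢l = newLine p 0 , inj₂ parent , ≢l
    ... | yes ≡l = newLine p 1 , inj₂ parent ,
                   λ e → contradiction (newLine-injective p (trans e (sym ≡l))) λ ()

    anotherPoint : ∀ l p → ∃[ q ] q A.I l × q ≢ p
    anotherPoint l p with newPoint l 0 ≟A p
    ... | no  ≢p = newPoint l 0 , inj₁ parent , ≢p
    ... | yes ≡p = newPoint l 1 , inj₁ parent ,
                   λ e → contradiction (newPoint-injective l (trans e (sym ≡p))) λ ()

    isQuadrangle : IsQuadrangle geometry
    isQuadrangle = record
      { somePoint    = ⟨ base x₀ 0 ⟩
      ; someLine     = ⟨ base y₀ 0 ⟩
      ; _≟ₚ_         = _≟A_
      ; _≟ₗ_         = _≟B_
      ; _I?_         = λ p l → raw p I? raw l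
      ; anotherLine  = anotherLine
      ; anotherPoint = anotherPoint
      ; projection   = projection
      ; noDigon      = noDigon
      ; noTriangle   = noTriangle
      }

    isThick : IsThickGeneralizedQuadrangle geometry
    isThick = record
      { isWeakGeneralized4gon = isQuadrangle⇒isWeakGeneralized4gon isQuadrangle
      ; ≥3-linesOn = λ p → record
          { to        = λ i → newLine p (toℕ i) , inj₂ parent
          ; cong      = cong (newLine p ∘ toℕ)
          ; injective = Fin.toℕ-injective ∘ newLine-injective p
          }
      ; ≥3-pointsOn = λ l → record
          { to        = λ i → newPoint l (toℕ i) , inj₁ parent
          ; cong      = cong (newPoint l ∘ toℕ)
          ; injective = Fin.toℕ-injective ∘ newPoint-injective l
          }
      }

    isInfinite : Infinite geometry
    isInfinite = mk↣ {to = λ n → ⟨ base x₀ n ⟩} λ { refl → refl }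

-- Mapping a free quadrangle onto a weak generalized quadrangle

-- In a cycle of length 8 a point and a line are at distance 1 or 3; in the first case the path
-- repeats an element.
4gon-projection : ∀ (i j : Fin 4) → let open Geometry (ordinaryGon 4) in
  ∃[ m ] ∃[ q ] i I m × q I m × q I j
4gon-projection = from-yes (Fin.all? λ i → Fin.all? λ j → Fin.any? λ m → Fin.any? λ q →
  I? i m ×-dec I? q m ×-dec I? q j)
  where
  I? : (i j : Fin 4) → Dec (i ≡ j ⊎ i ≡ next j)
  I? i j = (i Fin.≟ j) ⊎-dec (i Fin.≟ next j)

module _ {Γ : Geometry} (isWeak : IsWeakGeneralized4gon Γ) where
  open Geometry Γ
  open IsWeakGeneralized4gon isWeak using (nonempty; common4gon)

  -- Both points are vertices of a common 4-gon, where comparing them is comparing their indices in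
  -- `Fin 4`.
  ≟-point : DecidableEquality Point
  ≟-point p q with common4gon (inj₁ p) (inj₁ q)
  ... | S , (i , refl) , (j , refl) =
    map′ (cong (Sub.point S)) (Sub.point-injective S) (i Fin.≟ j)

  ≟-line : DecidableEquality Line
  ≟-line l m with common4gon (inj₂ l) (inj₂ m)
  ... | S , (i , refl) , (j , refl) =
    map′ (cong (Sub.line S)) (Sub.line-injective S) (i Fin.≟ j)

  Γ-projection : ∀ p l → ∃[ m ] ∃[ q ] p I m × q I m × q I l
  Γ-projection p l with common4gon (inj₁ p) (inj₂ l)
  ... | S , (i , refl) , (j , refl) =
    let open Sub S
        m , q , i-m , q-m , q-j = 4gon-projection i j
    in line m , point q , Equivalence.to (incidence i m) i-m ,
       Equivalence.to (incidence q m) q-m , Equivalence.to (incidence q j) q-j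

  open Free ≟-point ≟-line
    using (Pt; Ln; base; pt; ln; ⟨_⟩; geometry; parent; twin; module Thick; module Point′; module Line′)

  -- Twins go to the line and the point in the middle of a path in `Γ` between the images of their
  -- parents. The maps are total on raw elements, so the recursion carries no validity.
  collapseₚ : Pt → Point
  collapseₗ : Ln → Line

  collapseₚ (base x _) = x
  collapseₚ (pt p l)   = proj₁ (proj₂ (Γ-projection (collapseₚ p) (collapseₗ l)))

  collapseₗ (base y _) = y
  collapseₗ (ln p l)   = proj₁ (Γ-projection (collapseₚ p) (collapseₗ l))

  collapse-I : ∀ {p l} → Free._I_ ≟-point ≟-line p l → collapseₚ p I collapseₗ l
  collapse-I (inj₁ (parent {p} {l})) =
    proj₂ (proj₂ (proj₂ (proj₂ (Γ-projection (collapseₚ p) (collapseₗ l)))))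
  collapse-I (inj₁ (twin {p} {l})) =
    proj₁ (proj₂ (proj₂ (proj₂ (Γ-projection (collapseₚ p) (collapseₗ l)))))
  collapse-I (inj₂ (parent {p} {l})) =
    proj₁ (proj₂ (proj₂ (Γ-projection (collapseₚ p) (collapseₗ l))))
  collapse-I (inj₂ (twin {p} {l})) =
    proj₁ (proj₂ (proj₂ (proj₂ (Γ-projection (collapseₚ p) (collapseₗ l)))))

  collapse : Epimorphism geometry Γ
  collapse = record
    { morphism = record
        { onPoints           = collapseₚ ∘ Point′.raw
        ; onLines            = collapseₗ ∘ Line′.raw
        ; preservesIncidence = collapse-I
        }
    ; surjectiveOnPoints = λ x → ⟨ base x 0 ⟩ , λ { refl → refl }
    ; surjectiveOnLines  = λ y → ⟨ base y 0 ⟩ , λ { refl → refl }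
    }

  -- Labels for the fresh base elements that make the cover thick. The given element may be a point
  -- or a line, but a 4-gon through it has both.
  flag : Point × Line
  flag with common4gon nonempty nonempty
  ... | S , _ = Sub.point S 0F , Sub.line S 0F

  thickInfiniteCover : Σ[ A ∈ Geometry ]
    (IsThickGeneralizedQuadrangle A × Infinite A × Epimorphism A Γ)
  thickInfiniteCover = geometry , isThick , isInfinite , collapse
    where open Thick (proj₁ flag) (proj₂ flag)

-- The grid of order (s , 1)

module Grid (s : ℕ) where

  -- Coordinates, `s + 1` in number, as many as the points on a line of a geometry of order
  -- `(s , 1)`.
  X : Set
  X = Maybe (Fin s)

  _I_ : X × X → X ⊎ X → Set
  (a , b) I inj₁ x = a ≡ x
  (a , b) I inj₂ y = b ≡ y

  grid : Geometry
  grid = record { Point = X × X ; Line = X ⊎ X ; _I_ = _I_ }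

  hasOrder : HasOrder grid (Fin s) (Fin 1)
  hasOrder = record
    { pointsOn-size = λ
        { (inj₁ x) → record
            { to = λ y → (x , y) , refl
            ; cong = cong (x ,_)
            ; bijective = (λ { refl → refl }) , λ { ((_ , y) , refl) → y , λ { refl → refl } } }
        ; (inj₂ y) → record
            { to = λ x → (x , y) , refl
            ; cong = cong (_, y)
            ; bijective = (λ { refl → refl }) , λ { ((x , _) , refl) → x , λ { refl → refl } } }
        }
    ; linesOn-size = λ { (a , b) → record
        { to = λ { nothing → inj₁ a , refl ; (just _) → inj₂ b , refl }
        ; cong = λ { refl → refl }
        ; bijective =
            (λ { {nothing} {nothing} _ → refl ; {just 0F} {just 0F} _ → refl
               ; {nothing} {just _} () ; {just _} {nothing} () })
          , λ { (inj₁ _ , refl) → nothing , λ { refl → refl }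
              ; (inj₂ _ , refl) → just 0F , λ { refl → refl } }
        } }
    }

  module _ (other : ∀ (x : X) → ∃[ y ] y ≢ x) where

    isQuadrangle : IsQuadrangle grid
    isQuadrangle = record
      { somePoint    = nothing , nothing
      ; someLine     = inj₁ nothing
      ; _≟ₚ_         = ≡-dec _≟_ _≟_
      ; _≟ₗ_         = Sum.≡-dec _≟_ _≟_
      ; _I?_         = λ { (a , _) (inj₁ x) → a ≟ x ; (_ , b) (inj₂ y) → b ≟ y }
      ; anotherLine  = λ { (_ , b) (inj₁ _) → inj₂ b , refl , λ ()
                         ; (a , _) (inj₂ _) → inj₁ a , refl , λ () }
      ; anotherPoint = λ { (inj₁ x) (_ , b) → let y , y≢b = other b in
                             (x , y) , refl , y≢b ∘ cong proj₂
                         ; (inj₂ y) (a , _) → let x , x≢a = other a in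
                             (x , y) , refl , x≢a ∘ cong proj₁ }
      ; projection   = λ { (a , b) (inj₁ x) → inj₂ b , (x , b) , refl , refl , refl
                         ; (a , b) (inj₂ y) → inj₁ a , (a , y) , refl , refl , refl }
      ; noDigon      = λ {_} {_} {l} {m} → noDigon l m
      ; noTriangle   = λ {_} {_} {_} {l} {m} {n} → noTriangle l m n
      }
      where
      _≟_ : DecidableEquality X
      _≟_ = Maybe.≡-dec Fin._≟_

      -- Lines of one parallel class that share a point coincide, and two lines of different classes
      -- fix both coordinates of a common point.
      noDigon : ∀ {p q} l m → p I l → q I l → p I m → q I m → p ≢ q → l ≢ m → ⊥
      noDigon (inj₁ _) (inj₁ _) refl _    refl _    _   l≢m = l≢m refl
      noDigon (inj₁ _) (inj₂ _) refl refl refl refl p≢q _   = p≢q refl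
      noDigon (inj₂ _) (inj₁ _) refl refl refl refl p≢q _   = p≢q refl
      noDigon (inj₂ _) (inj₂ _) refl _    refl _    _   l≢m = l≢m refl

      -- Two of the three lines belong to the same parallel class, and they share a vertex.
      noTriangle : ∀ {p q r} l m n → p I l → q I l → q I m → r I m → r I n → p I n →
                   p ≢ q → q ≢ r → r ≢ p → l ≢ m → m ≢ n → n ≢ l → ⊥
      noTriangle (inj₁ _) (inj₁ _) _ _ refl refl _ _ _ _ _ _ l≢m _ _ = l≢m refl
      noTriangle (inj₂ _) (inj₂ _) _ _ refl refl _ _ _ _ _ _ l≢m _ _ = l≢m refl
      noTriangle _ (inj₁ _) (inj₁ _) _ _ _ refl refl _ _ _ _ _ m≢n _ = m≢n refl
      noTriangle _ (inj₂ _) (inj₂ _) _ _ _ refl refl _ _ _ _ _ m≢n _ = m≢n refl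
      noTriangle (inj₁ _) _ (inj₁ _) refl _ _ _ _ refl _ _ _ _ _ n≢l = n≢l refl
      noTriangle (inj₂ _) _ (inj₂ _) refl _ _ _ _ refl _ _ _ _ _ n≢l = n≢l refl

    isGrid : IsGrid (finite s) grid
    isGrid = record
      { isWeakGeneralized4gon = isQuadrangle⇒isWeakGeneralized4gon isQuadrangle
      ; hasOrder              = hasOrder
      }

mainTheorem4 : ((s′ : CountableCardinal) → 1< s′ → (Γ : Geometry) → IsGrid s′ Γ →
    Σ[ A ∈ Geometry ] (IsThickGeneralizedQuadrangle A × Infinite A × Epimorphism A Γ))
    ×
    (Σ[ s′ ∈ CountableCardinal ] Σ[ Γ ∈ Geometry ] Σ[ A ∈ Geometry ]
    (IsGrid s′ Γ × IsThickGeneralizedQuadrangle A × Infinite A × Epimorphism A Γ × s′ ≢ finite 1))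
-- The second half is witnessed by the 3 by 3 grid, of order `(2 , 1)`, and the cover that the first
-- half gives for it.
mainTheorem4 = cover , finite 2 , grid , proj₁ A , isGrid′ ,
               proj₁ (proj₂ A) , proj₁ (proj₂ (proj₂ A)) , proj₂ (proj₂ (proj₂ A)) , λ ()
  where
  open Grid 2

  cover : (s′ : CountableCardinal) → 1< s′ → (Γ : Geometry) → IsGrid s′ Γ →
          Σ[ A ∈ Geometry ] (IsThickGeneralizedQuadrangle A × Infinite A × Epimorphism A Γ)
  cover _ _ _ isGrid = thickInfiniteCover (IsGrid.isWeakGeneralized4gon isGrid)

  isGrid′ : IsGrid (finite 2) grid
  isGrid′ = isGrid λ { nothing → just 0F , λ () ; (just _) → nothing , λ () }

  A : Σ[ A ∈ Geometry ] (IsThickGeneralizedQuadrangle A × Infinite A × Epimorphism A grid)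
  A = cover (finite 2) (s≤s (s≤s z≤n)) grid isGrid′
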